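{- The maximum of the inclusterability index $Q(P,\sigma)$ over all signatures $\sigma$ of the Petersen graph $P$ equals $3$.
   Context: The Petersen graph $P$ has vertices $v_{ij}$ for the 2-element subsets $\{i,j\}\subseteq\{1,\dots,5\}$, with $v_{ij}v_{kl}$ an edge iff $\{i,j\}\cap\{k,l\}=\emptyset$; a signature is $\sigma:E(P)\to\{+,-\}$. A signed graph is clusterable if its vertex set can be partitioned into sets (clusters) such that every edge within a cluster is positive and every edge between two clusters is negative. The inclusterability index $Q$ is the smallest number of edges whose deletion leaves a clusterable signed graph. -}

module Defs where

open import Data.Nat using (ℕ; _≤_; _<_; _+_; _*_)
open import Data.Fin using (Fin; toℕ) renaming (_<_ to _<ᶠ_)
open import Data.Fin.Properties using (_≟_)
open import Data.Bool using (Bool; true; false; T; not; _∧_)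
open import Data.Product using (Σ; ∃; ∃-syntax; _×_; _,_; proj₁; proj₂)
open import Data.List using (List; length)
open import Data.List.Membership.Propositional using (_∉_)
open import Data.List.Relation.Unary.Unique.Propositional using (Unique)
open import Relation.Binary.PropositionalEquality using (_≡_; _≢_)
open import Relation.Nullary.Decidable using (⌊_⌋)

-- Vertices of the Petersen graph: 2-element subsets {i,j} of a 5-element set,
-- represented as pairs (i , j) of elements of Fin 5 with i < j.
Vertex : Set
Vertex = Σ (Fin 5 × Fin 5) (λ p → proj₁ p <ᶠ proj₂ p)

fst snd : Vertex → Fin 5
fst v = proj₁ (proj₁ v)
snd v = proj₂ (proj₁ v)

disjointᵇ : Vertex → Vertex → Bool
disjointᵇ u v =
  not ⌊ fst u ≟ fst v ⌋ ∧ not ⌊ fst u ≟ snd v ⌋ ∧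
  not ⌊ snd u ≟ fst v ⌋ ∧ not ⌊ snd u ≟ snd v ⌋

-- a numeric code of a vertex, used only to orient each (undirected) edge once
code : Vertex → ℕ
code v = toℕ (fst v) * 5 + toℕ (snd v)

-- Edges of the Petersen graph: unordered pairs {u,v} of disjoint 2-subsets,
-- each represented once (with code u < code v).
record Edge : Set where
  constructor edge
  field
    u   : Vertex
    v   : Vertex
    adj : T (disjointᵇ u v)
    ord : code u < code v
open Edge public

data Sign : Set where
  pos neg : Sign

Signature : Set
Signature = Edge → Sign

-- The signed graph (P − D, σ) (D a set of edges, given as a list) is clusterable:
-- there is a partition of the vertices into clusters (given by a labelling
-- c : Vertex → ℕ, clusters = fibres of c) such that every remaining edge inside
-- a cluster is positive and every remaining edge between clusters is negative.
ClusterableAfterDeleting : Signature → List Edge → Set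
ClusterableAfterDeleting σ D =
  Σ (Vertex → ℕ) λ c → ∀ (e : Edge) → e ∉ D →
    (c (u e) ≡ c (v e) → σ e ≡ pos) × (c (u e) ≢ c (v e) → σ e ≡ neg)

IsInclusterabilityIndex : Signature → ℕ → Set
IsInclusterabilityIndex σ q =
  (∃[ D ] (Unique D × length D ≡ q × ClusterableAfterDeleting σ D)) ×
  (∀ (D : List Edge) → Unique D → ClusterableAfterDeleting σ D → q ≤ length D)

{-# OPTIONS --safe #-}
-- Upper bound: already the partitions into two clusters suffice.  The signatures they
-- satisfy exactly form the cut space of P, a binary code of length 15 whose covering
-- radius is 3.
--
-- Lower bound: let the negative edges be the three edges that avoid the element 4.  Then
-- each of the 12 pentagons of P has exactly one negative edge, so it must lose an edge,
-- and every edge lies on only 4 pentagons.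
module Submission where

open import Defs
open import Data.Bool using (Bool; true; false; T; not; _∧_; if_then_else_)
open import Data.Bool.Properties using (T?; T-irrelevant; T-∧; T-≡)
open import Data.Fin using (Fin; #_)
import Data.Fin as Fin
import Data.Fin.Properties as Fin
open import Data.List
  using (List; []; _∷_; map; concatMap; filter; length; allFin; cartesianProduct; null)
open import Data.List.Membership.Propositional using (_∈_; _∉_; lose)
open import Data.List.Membership.Propositional.Properties
  using (∈-allFin; ∈-cartesianProduct⁺; ∈-map⁺; ∈-filter⁺; ∈-filter⁻)
import Data.List.Membership.DecPropositional as DecMembership
open import Data.List.Relation.Binary.Sublist.Propositional using (_⊆_)
import Data.List.Relation.Binary.Sublist.Propositional.Properties as Sublist
open import Data.List.Relation.Unary.All using (all?)
import Data.List.Relation.Unary.All as All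
open import Data.List.Relation.Unary.Any using (Any; here; there; any?; satisfied)
import Data.List.Relation.Unary.Any as Any
import Data.List.Relation.Unary.Any.Properties as Any
open import Data.List.Relation.Unary.Unique.Propositional using (Unique)
open import Data.List.Relation.Unary.Unique.Propositional.Properties using (filter⁺)
import Data.List.Relation.Unary.Unique.DecPropositional as DecUnique
open import Data.Nat using (ℕ; zero; suc; _+_; _*_; _≤_; _<_; z≤n; s≤s; _≡ᵇ_; _≤?_; _<?_; _≟_)
open import Data.Nat.Properties
  using (<-irrelevant; ≤-trans; +-mono-≤; *-cancelʳ-≤; n≤1+n; ≤-refl; ≤-reflexive; +-suc; module ≤-Reasoning)
open import Data.Product using (Σ; _×_; _,_; proj₁; proj₂; ∃-syntax)
open import Data.Product.Properties using (≡-dec)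
open import Data.Vec using (Vec; []; _∷_; fromList)
import Data.Vec as Vec
open import Function using (_∘_; const; case_of_; Equivalence)
open import Relation.Binary using (DecidableEquality)
open import Relation.Binary.PropositionalEquality using (_≡_; _≢_; refl; sym; trans; cong)
open import Relation.Nullary using (yes; no; Irrelevant; does; contradiction)
open import Relation.Nullary.Decidable using (map′; _×-dec_; ¬?; from-yes; dec-true; dec-false; decidable-stable)
open import Relation.Unary using (Decidable)

-- Enumerating the edges of P

module _ {A : Set} {P : A → Set} (P? : Decidable P) where

  restrict : List A → List (Σ A P)
  restrict [] = []
  restrict (x ∷ xs) with P? x
  ... | yes px = (x , px) ∷ restrict xs
  ... | no _   = restrict xs

  -- Entries of `restrict` carry the proof found by `P?`; irrelevance identifies it with the given
  -- `px`.
  ∈-restrict : (∀ {x} → Irrelevant (P x)) → ∀ {x xs} → x ∈ xs → (px : P x) → (x , px) ∈ restrict xs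
  ∈-restrict irr {x} {y ∷ _} x∈ px with P? y | x∈
  ... | yes py | here refl = here (cong (x ,_) (irr px py))
  ... | yes _  | there x∈′ = there (∈-restrict irr x∈′ px)
  ... | no ¬py | here refl = contradiction px ¬py
  ... | no _   | there x∈′ = ∈-restrict irr x∈′ px

increasing? : Decidable {A = Fin 5 × Fin 5} (λ p → proj₁ p Fin.< proj₂ p)
increasing? (i , j) = i Fin.<? j

vertices : List Vertex
vertices = restrict increasing? (cartesianProduct (allFin 5) (allFin 5))

∈-vertices : ∀ x → x ∈ vertices
∈-vertices ((i , j) , i<j) =
  ∈-restrict increasing? <-irrelevant (∈-cartesianProduct⁺ (∈-allFin i) (∈-allFin j)) i<j

IsOriented : Vertex × Vertex → Set
IsOriented (x , y) = T (disjointᵇ x y) × code x < code y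

IsOriented? : Decidable IsOriented
IsOriented? (x , y) = T? (disjointᵇ x y) ×-dec (code x <? code y)

IsOriented-irrelevant : ∀ {xy} → Irrelevant (IsOriented xy)
IsOriented-irrelevant (a , o) (a′ , o′) with T-irrelevant a a′ | <-irrelevant o o′
... | refl | refl = refl

toEdge : Σ (Vertex × Vertex) IsOriented → Edge
toEdge ((x , y) , a , o) = edge x y a o

edges : List Edge
edges = map toEdge (restrict IsOriented? (cartesianProduct vertices vertices))

∈-edges : ∀ e → e ∈ edges
∈-edges (edge x y a o) = ∈-map⁺ toEdge
  (∈-restrict IsOriented? (λ {xy} → IsOriented-irrelevant {xy})
    (∈-cartesianProduct⁺ (∈-vertices x) (∈-vertices y)) (a , o))

_≟ᵛ_ : DecidableEquality Vertex
((i , j) , p) ≟ᵛ ((k , l) , q) = map′ ext (cong proj₁) (≡-dec Fin._≟_ Fin._≟_ (i , j) (k , l))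
  where
  ext : ∀ {ij kl p q} → ij ≡ kl → _≡_ {A = Vertex} (ij , p) (kl , q)
  ext {p = p} {q} refl = cong (_ ,_) (<-irrelevant p q)

_≟ᵉ_ : DecidableEquality Edge
edge x y a o ≟ᵉ edge x′ y′ a′ o′ =
  map′ ext (λ { refl → refl , refl }) ((x ≟ᵛ x′) ×-dec (y ≟ᵛ y′))
  where
  ext : ∀ {x y x′ y′ a o a′ o′} → x ≡ x′ × y ≡ y′ → edge x y a o ≡ edge x′ y′ a′ o′
  ext {x} {y} {a = a} {o} {a′} {o′} (refl , refl) =
    cong (λ p → toEdge ((x , y) , p)) (IsOriented-irrelevant {x , y} (a , o) (a′ , o′))

open DecMembership _≟ᵉ_ using (_∈?_)

edges-unique : Unique edges
edges-unique = from-yes (DecUnique.unique? _≟ᵉ_ edges)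

-- The upper bound

_≟ˢ_ : DecidableEquality Sign
pos ≟ˢ pos = yes refl
pos ≟ˢ neg = no λ ()
neg ≟ˢ pos = no λ ()
neg ≟ˢ neg = yes refl

inducedSign : (Vertex → ℕ) → Signature
inducedSign c e = if does (c (u e) ≟ c (v e)) then pos else neg

disagree? : (σ τ : Signature) → Decidable (λ e → σ e ≢ τ e)
disagree? σ τ e = ¬? (σ e ≟ˢ τ e)

mismatches : Signature → Signature → List Edge → List Edge
mismatches σ τ = filter (disagree? σ τ)

-- An edge that is not deleted has the sign prescribed by `c`, which is positive exactly inside the
-- clusters.
mismatches-clusterable : ∀ {es} → (∀ e → e ∈ es) →
                         ∀ σ c → ClusterableAfterDeleting σ (mismatches σ (inducedSign c) es)
mismatches-clusterable ∈-es σ c = c , λ e e∉ →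
  agree e (decidable-stable (σ e ≟ˢ inducedSign c e)
    λ σ≢ → e∉ (∈-filter⁺ (disagree? σ (inducedSign c)) (∈-es e) σ≢))
  where
  agree : ∀ e → σ e ≡ inducedSign c e →
          (c (u e) ≡ c (v e) → σ e ≡ pos) × (c (u e) ≢ c (v e) → σ e ≡ neg)
  agree e eq = via true ∘ dec-true d , via false ∘ dec-false d
    where
    d = c (u e) ≟ c (v e)
    via : ∀ b → does d ≡ b → σ e ≡ (if b then pos else neg)
    via _ = trans eq ∘ cong (if_then pos else neg)

distance : ∀ {n} → Vec Sign n → Vec Sign n → ℕ
distance [] [] = 0
distance (s ∷ w) (t ∷ p) with s ≟ˢ t
... | yes _ = distance w p
... | no _  = suc (distance w p)

length-mismatches : ∀ σ τ es →
  length (mismatches σ τ es) ≡ distance (Vec.map σ (fromList es)) (Vec.map τ (fromList es))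
length-mismatches σ τ [] = refl
length-mismatches σ τ (e ∷ es) with σ e ≟ˢ τ e
... | yes _ = length-mismatches σ τ es
... | no _  = cong suc (length-mismatches σ τ es)

-- A Hamming ball, given by its centre and its radius.
Ball : ℕ → Set
Ball n = Vec Sign n × ℕ

_∈ᴮ_ : ∀ {n} → Vec Sign n → Ball n → Set
w ∈ᴮ (p , r) = distance w p ≤ r

-- The section of each ball by the words that begin with `s`. A centre that begins with the other
-- sign costs one unit of radius, so a ball of radius 0 has an empty section there and is dropped.
slice : ∀ {n} → Sign → List (Ball (suc n)) → List (Ball n)
slice s [] = []
slice s ((t ∷ p , r) ∷ bs) with s ≟ˢ t | r
... | yes _ | _      = (p , r) ∷ slice s bs
... | no _  | zero   = slice s bs
... | no _  | suc r′ = (p , r′) ∷ slice s bs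

distance-∷-≡ : ∀ {n s t} {w p : Vec Sign n} → s ≡ t → distance (s ∷ w) (t ∷ p) ≡ distance w p
distance-∷-≡ {s = s} {t} s≡t with s ≟ˢ t
... | yes _  = refl
... | no s≢t = contradiction s≡t s≢t

distance-∷-≤ : ∀ {n} s t {w p : Vec Sign n} → distance (s ∷ w) (t ∷ p) ≤ suc (distance w p)
distance-∷-≤ s t with s ≟ˢ t
... | yes _ = n≤1+n _
... | no _  = ≤-refl

∈-slice : ∀ {n} s {w : Vec Sign n} bs → Any (w ∈ᴮ_) (slice s bs) → Any ((s ∷ w) ∈ᴮ_) bs
∈-slice s ((t ∷ p , r) ∷ bs) w∈ with s ≟ˢ t | r | w∈
... | yes s≡t | _     | here d≤r  = here (≤-trans (≤-reflexive (distance-∷-≡ s≡t)) d≤r)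
... | yes _   | _     | there w∈′ = there (∈-slice s bs w∈′)
... | no _    | zero  | w∈′       = there (∈-slice s bs w∈′)
... | no _    | suc _ | here d≤r  = here (≤-trans (distance-∷-≤ s t) (s≤s d≤r))
... | no _    | suc _ | there w∈′ = there (∈-slice s bs w∈′)

-- Slicing one coordinate at a time drops the balls that are already missed, which is
-- much cheaper than comparing all 2ⁿ words with all balls.
covers : ∀ n → List (Ball n) → Bool
covers zero    bs = not (null bs)
covers (suc n) bs = covers n (slice pos bs) ∧ covers n (slice neg bs)

covers-sound : ∀ n bs → T (covers n bs) → ∀ w → Any (w ∈ᴮ_) bs
-- At length 0 any surviving ball contains the empty word, whatever its radius.
covers-sound zero    (([] , _) ∷ _) _ [] = here z≤n
covers-sound (suc n) bs cov (s ∷ w) with Equivalence.to T-∧ cov | s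
... | covPos , _ | pos = ∈-slice pos bs (covers-sound n _ covPos w)
... | _ , covNeg | neg = ∈-slice neg bs (covers-sound n _ covNeg w)

-- The indicator functions of all subsets of the list. Their induced signatures are the cuts, with
-- the crossing edges negative.
bipartitions : List Vertex → List (Vertex → ℕ)
bipartitions []       = const 0 ∷ []
bipartitions (x ∷ xs) =
  concatMap (λ c → c ∷ (λ y → if code x ≡ᵇ code y then 1 else c y) ∷ []) (bipartitions xs)

ball : ∀ es → ℕ → (Vertex → ℕ) → Ball (length es)
ball es r c = Vec.map (inducedSign c) (fromList es) , r

-- Read `σ` as a word indexed by `es`. Some induced signature lies within distance `r` of it, and
-- deleting the edges where the two differ leaves a clusterable graph.
index-bound : ∀ es r cs → (∀ e → e ∈ es) → Unique es →
              covers (length es) (map (ball es r) cs) ≡ true →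
              ∀ σ q → IsInclusterabilityIndex σ q → q ≤ r
index-bound es r cs ∈-es uniq cov σ q (_ , minimal)
  with satisfied (Any.map⁻ (covers-sound (length es) (map (ball es r) cs)
                             (Equivalence.from T-≡ cov) (Vec.map σ (fromList es))))
... | c , d≤r = ≤-trans
  (minimal (mismatches σ (inducedSign c) es)
    (filter⁺ (disagree? σ (inducedSign c)) uniq)
    (mismatches-clusterable ∈-es σ c))
  (≤-trans (≤-reflexive (length-mismatches σ (inducedSign c) es)) d≤r)

-- The bound 3 on the covering radius of the cut space, verified by evaluation.
cuts-cover : covers (length edges) (map (ball edges 3) (bipartitions vertices)) ≡ true
cuts-cover = refl

index≤3 : ∀ σ q → IsInclusterabilityIndex σ q → q ≤ 3
index≤3 = index-bound edges 3 (bipartitions vertices) ∈-edges edges-unique cuts-cover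

-- The lower bound

length-filter-split : ∀ {A : Set} {P : A → Set} (P? : Decidable P) xs →
                      length xs ≡ length (filter P? xs) + length (filter (¬? ∘ P?) xs)
length-filter-split P? [] = refl
length-filter-split P? (x ∷ xs) with P? x
... | yes _ = cong suc (length-filter-split P? xs)
... | no _  = trans (cong suc (length-filter-split P? xs)) (sym (+-suc _ _))

module _ {A B : Set} {_meets_ : A → B → Set} (meets? : ∀ y → Decidable (_meets y)) where

  -- Induction on `ys`: the head `y` accounts for at most `k` entries of `xs`, and the entries it
  -- misses are met by the tail.
  transversal-bound : ∀ k xs ys → (∀ y → length (filter (meets? y) xs) ≤ k) →
                      (∀ {x} → x ∈ xs → Any (x meets_) ys) → length xs ≤ length ys * k
  transversal-bound k []      []       few met = z≤n
  transversal-bound k (_ ∷ _) []       few met with () ← met (here refl)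
  transversal-bound k xs      (y ∷ ys) few met = begin
    length xs                                     ≡⟨ length-filter-split (meets? y) xs ⟩
    length (filter (meets? y) xs) + length missed ≤⟨ +-mono-≤ (few y) rest ⟩
    k + length ys * k                             ∎
    where
    open ≤-Reasoning
    missed = filter (¬? ∘ meets? y) xs
    -- The bound `few` passes to `missed` because filtering preserves the sublist relation.
    missed-through : ∀ z → filter (meets? z) missed ⊆ filter (meets? z) xs
    missed-through z =
      Sublist.filter⁺ (meets? z) (meets? z) (λ { refl p → p }) (Sublist.filter-⊆ (¬? ∘ meets? y) xs)
    rest : length missed ≤ length ys * k
    rest = transversal-bound k missed ys
      (λ z → ≤-trans (Sublist.length-mono-≤ (missed-through z)) (few z))
      (λ x∈ → let x∈xs , ¬xy = ∈-filter⁻ (¬? ∘ meets? y) x∈ in Any.tail ¬xy (met x∈xs))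

module _ (σ : Signature) where

  -- Each edge is stored in one orientation only, hence a constructor for either direction of
  -- travel.
  data PositiveWalk : Vertex → Vertex → Set where
    stop  : ∀ {x} → PositiveWalk x x
    along : ∀ {y} e → σ e ≡ pos → PositiveWalk (v e) y → PositiveWalk (u e) y
    back  : ∀ {y} e → σ e ≡ pos → PositiveWalk (u e) y → PositiveWalk (v e) y

  trail : ∀ {x y} → PositiveWalk x y → List Edge
  trail stop          = []
  trail (along e _ w) = e ∷ trail w
  trail (back e _ w)  = e ∷ trail w

  -- A closed walk with exactly one negative edge: the obstruction in Davis's criterion for
  -- clusterability.
  NegativeCircuit : Set
  NegativeCircuit = ∃[ e ] (σ e ≡ neg × PositiveWalk (u e) (v e))

  circuit : NegativeCircuit → List Edge
  circuit (e , _ , w) = e ∷ trail w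

  -- If no edge of the circuit were deleted, the label `c` would be constant along the positive
  -- walk, so the ends of the negative edge would share a cluster.
  circuit-meets : ∀ {D} → ClusterableAfterDeleting σ D → ∀ C → Any (_∈ circuit C) D
  circuit-meets {D} (c , cl) (e , σe , w) =
    decidable-stable (any? (_∈? (e ∷ trail w)) D) λ untouched →
      let kept : ∀ {f} → f ∈ (e ∷ trail w) → f ∉ D
          kept f∈ f∈D = untouched (lose f∈D f∈)
      in separated (kept (here refl)) (connected w (kept ∘ there))
    where
    joined : ∀ f → σ f ≡ pos → f ∉ D → c (u f) ≡ c (v f)
    joined f σf f∉ = decidable-stable (c (u f) ≟ c (v f))
      λ c≢ → case trans (sym σf) (proj₂ (cl f f∉) c≢) of λ ()

    connected : ∀ {x y} (w : PositiveWalk x y) → (∀ {f} → f ∈ trail w → f ∉ D) → c x ≡ c y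
    connected stop           kept = refl
    connected (along f σf w) kept =
      trans (joined f σf (kept (here refl))) (connected w (kept ∘ there))
    connected (back f σf w)  kept =
      trans (sym (joined f σf (kept (here refl)))) (connected w (kept ∘ there))

    separated : e ∉ D → c (u e) ≢ c (v e)
    separated e∉ c≡ = case trans (sym σe) (proj₁ (cl e e∉) c≡) of λ ()

  positiveWalks : ℕ → ∀ x y → List (PositiveWalk x y)
  positiveWalks zero x y with x ≟ᵛ y
  ... | yes refl = stop ∷ []
  ... | no _     = []
  positiveWalks (suc n) x y = concatMap step edges
    where
    step : Edge → List (PositiveWalk x y)
    step e with σ e ≟ˢ pos | u e ≟ᵛ x | v e ≟ᵛ x
    ... | yes σe | yes refl | _        = map (along e σe) (positiveWalks n (v e) y)
    ... | yes σe | no _     | yes refl = map (back e σe) (positiveWalks n (u e) y)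
    ... | _      | _        | _        = []

  -- Here `n` counts the positive edges, so the closed walks have length `n + 1`. Starting each walk
  -- at `u e` for its only negative edge `e` fixes the base point and the direction.
  negativeCircuits : ℕ → List NegativeCircuit
  negativeCircuits n = concatMap close edges
    where
    close : Edge → List NegativeCircuit
    close e with σ e ≟ˢ neg
    ... | yes σe = map (λ w → e , σe , w) (positiveWalks n (u e) (v e))
    ... | no _   = []

-- The larger element is stored second, so 4 can occur only there.
avoids4 : Vertex → Bool
avoids4 x = not (does (snd x Fin.≟ # 4))

-- Vertices avoiding 4 are the edges of a `K₄` on the other four elements; two disjoint ones form a
-- perfect matching, and there are three of these.
K₄-matchings : Signature
K₄-matchings e = if avoids4 (u e) ∧ avoids4 (v e) then neg else pos

-- P has girth 5, so these closed walks of length 5 are pentagons.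
pentagons : List (NegativeCircuit K₄-matchings)
pentagons = negativeCircuits K₄-matchings 4

through? : ∀ e → Decidable (λ C → e ∈ circuit K₄-matchings C)
through? e C = e ∈? circuit K₄-matchings C

-- Checked edge by edge. The value agrees with counting incidences: 12 pentagons with 5 edges each,
-- spread over 15 edges.
pentagons-through : ∀ e → length (filter (through? e) pentagons) ≤ 4
pentagons-through e = All.lookup
  (from-yes (all? (λ f → length (filter (through? f) pentagons) ≤? 4) edges)) (∈-edges e)

deletions≥3 : ∀ D → ClusterableAfterDeleting K₄-matchings D → 3 ≤ length D
-- The list `pentagons` evaluates to 12 entries, which is `3 * 4`.
deletions≥3 D cl = *-cancelʳ-≤ 3 (length D) 4
  (transversal-bound through? 4 pentagons D pentagons-through
    λ {C} _ → circuit-meets K₄-matchings cl C)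

deletions≤3 : ∃[ D ] (Unique D × length D ≡ 3 × ClusterableAfterDeleting K₄-matchings D)
-- With all vertices in one cluster, the mismatches are exactly the three negative edges.
deletions≤3 = mismatches K₄-matchings (inducedSign (const 0)) edges
  , filter⁺ (disagree? K₄-matchings (inducedSign (const 0))) edges-unique
  , refl
  , mismatches-clusterable ∈-edges K₄-matchings (const 0)

theorem10p5 : ((σ : Signature) (q : ℕ) → IsInclusterabilityIndex σ q → q ≤ 3) × (∃[ σ ] IsInclusterabilityIndex σ 3)
theorem10p5 = index≤3 , K₄-matchings , deletions≤3 , λ D _ → deletions≥3 D
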